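{- Let $(W,S)$ be a finite Coxeter system with identity $e$ and Bruhat order $\le$. For $v\in W$ define the Bruhat size $|v|=R_{ev}(2)$ (i.e. the value at $q=1$ of the shifted polynomial $R_{ev}(q+1)$). Then: (1) if $u\le v$ then $|u|\le |v|$; (2) $|v|$ is odd for every $v\in W$.
   Context: The Kazhdan–Lusztig $R$-polynomials $R_{uw}(q)\in\mathbb{Z}[q]$ are the unique family with $R_{uw}=0$ if $u\not\le w$, $R_{uu}=1$, and, for $s\in S$ with $\ell(ws)<\ell(w)$ ($\ell$ the length function): $R_{uw}=R_{us,ws}$ if $\ell(us)<\ell(u)$, and $R_{uw}=(q-1)R_{u,ws}+qR_{us,ws}$ if $\ell(us)>\ell(u)$. -}

module Defs where

open import Level using (0ℓ)
open import Data.Nat as ℕ using (ℕ; zero; suc)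
open import Data.Fin using (Fin)
open import Data.List using (List; []; _∷_; length)
open import Data.Integer as ℤ using (ℤ; +_)
open import Data.Product using (Σ; ∃; ∃-syntax; _×_; _,_)
open import Relation.Nullary using (¬_)
open import Relation.Binary.PropositionalEquality using (_≡_; _≢_)
open import Relation.Binary.Definitions using (DecidableEquality)
open import Relation.Binary.Construct.Closure.ReflexiveTransitive using (Star)
open import Algebra.Bundles using (Group)

pow : {A : Set} → (A → A → A) → A → A → ℕ → A
pow _∙_ ε x zero    = ε
pow _∙_ ε x (suc k) = x ∙ pow _∙_ ε x k

-- A finite Coxeter system (W,S) of rank n with Coxeter matrix m.
-- W is a group (with propositional equality, decidable), finite, generated by
-- S = {s i}, and W is *presented* by S subject to (s i s j)^(m i j) = e:
-- every assignment of the generators into any group satisfying these relations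
-- extends to a group homomorphism.
-- product s i₁ · s i₂ · … · s iₖ of a word
evalWord : {A : Set} {I : Set} → (A → A → A) → A → (I → A) → List I → A
evalWord _∙_ ε g []      = ε
evalWord _∙_ ε g (i ∷ w) = g i ∙ evalWord _∙_ ε g w

record CoxeterSystem : Set₁ where
  field
    W     : Set
    _·_   : W → W → W
    e     : W
    inv   : W → W
    ·-assoc : ∀ x y z → (x · y) · z ≡ x · (y · z)
    ·-idˡ   : ∀ x → e · x ≡ x
    ·-idʳ   : ∀ x → x · e ≡ x
    ·-invˡ  : ∀ x → inv x · x ≡ e
    ·-invʳ  : ∀ x → x · inv x ≡ e
    _≟W_  : DecidableEquality W
    size  : ℕ
    enum  : Fin size → W
    enum-surj : ∀ w → ∃[ k ] enum k ≡ w
    n     : ℕ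
    m     : Fin n → Fin n → ℕ
    m-diag : ∀ i → m i i ≡ 1
    m-sym  : ∀ i j → m i j ≡ m j i
    m-off  : ∀ i j → i ≢ j → 2 ℕ.≤ m i j
    s     : Fin n → W

  field
    relations : ∀ i j → pow _·_ e (s i · s j) (m i j) ≡ e
    generates : ∀ w → ∃[ ws ] evalWord _·_ e s ws ≡ w
    universal : (G : Group 0ℓ 0ℓ) (f : Fin n → Group.Carrier G) →
                (∀ i j → Group._≈_ G (pow (Group._∙_ G) (Group.ε G) (Group._∙_ G (f i) (f j)) (m i j)) (Group.ε G)) →
                Σ (W → Group.Carrier G) λ φ →
                  (∀ x y → Group._≈_ G (φ (x · y)) (Group._∙_ G (φ x) (φ y))) ×
                  (∀ i → Group._≈_ G (φ (s i)) (f i))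

module _ (C : CoxeterSystem) where
  open CoxeterSystem C

  eval : List (Fin n) → W
  eval = evalWord _·_ e s

  HasLength : W → ℕ → Set
  HasLength w k = (∃[ ws ] (length ws ≡ k × eval ws ≡ w))
                × (∀ ws → eval ws ≡ w → k ℕ.≤ length ws)

  Shorter : W → W → Set
  Shorter x y = ∃[ a ] ∃[ b ] (HasLength x a × HasLength y b × a ℕ.< b)

  IsReflection : W → Set
  IsReflection t = ∃[ w ] ∃[ i ] t ≡ (w · s i) · inv w

  BruhatStep : W → W → Set
  BruhatStep u w = ∃[ t ] (IsReflection t × w ≡ u · t × Shorter u w)

  _≤B_ : W → W → Set
  _≤B_ = Star BruhatStep

  -- R-polynomials, represented by their polynomial functions ℤ → ℤ
  record IsRFamily (R : W → W → ℤ → ℤ) : Set where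
    field
      R-not≤ : ∀ u w → ¬ (u ≤B w) → ∀ q → R u w q ≡ + 0
      R-refl : ∀ u q → R u u q ≡ + 1
      R-down : ∀ u w i → Shorter (w · s i) w → Shorter (u · s i) u → ∀ q →
               R u w q ≡ R (u · s i) (w · s i) q
      R-up   : ∀ u w i → Shorter (w · s i) w → Shorter u (u · s i) → ∀ q →
               R u w q ≡ ((q ℤ.- + 1) ℤ.* R u (w · s i) q) ℤ.+ (q ℤ.* R (u · s i) (w · s i) q)

  bruhatSize : (R : W → W → ℤ → ℤ) → W → ℤ
  bruhatSize R v = R e v (+ 2)

OddInt : ℤ → Set
OddInt x = ∃[ k ] x ≡ + 1 ℤ.+ (+ 2 ℤ.* k)

{-# OPTIONS --safe #-}
module Submission where

-- At q = 2 the recursion reads R_{·,ws} = ρ_s R_{·,w} for ws > w, where ρ_s is a monotone operator on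
-- functions W → ℕ, so R_{·,w} = ρ_{s_k} ⋯ ρ_{s_1} δ_e for a reduced word s_1 ⋯ s_k of w. The ρ's commute
-- with their left-handed analogues, which agree with them on δ_e; since δ_e ≤ ρ_s δ_e, this gives
-- f ≤ ρ_s f for every f = ρ_{s_i} ⋯ ρ_{s_1} δ_e, and together with g ≤ ρ_s ρ_s g it shows that deleting
-- a letter of a reduced word can only decrease R_{·,w}. By strong exchange every Bruhat step is such a
-- deletion. Strong exchange comes from extending s ↦ (δ_s , s) to a homomorphism W → 2^W ⋊ W,
-- whose first component records left inversions. Oddness: (ρ_s f)(e) = f(e) + 2 f(s).

open import Defs
open import Data.Integer using (ℤ; _≤_)
open import Data.Product using (_×_)

open import Algebra.Bundles using (Group)
import Algebra.Properties.Group as GroupProperties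
import Algebra.Properties.Loop as LoopProperties
import Algebra.Properties.Quasigroup as QuasigroupProperties
open import Data.Bool.Base using (Bool; true; false; not; _xor_; if_then_else_)
open import Data.Bool.Properties using
  (xor-assoc; xor-comm; xor-same; xor-identityʳ)
open import Data.Fin.Base using (Fin)
open import Data.Fin.Properties using (any?)
open import Data.Integer.Base as ℤ using (+≤+) renaming (+_ to pos)
import Data.Integer.Properties as ℤ
open import Data.List.Base using (List; []; _∷_; _++_; length)
open import Data.List.Properties using (length-++)
open import Data.Nat.Base as ℕ using (ℕ; zero; suc; _+_; _*_; z≤n; s≤s)
import Data.Nat.Properties as ℕ
open import Data.Nat.Tactic.RingSolver using (solve-∀)
open import Data.Product using (Σ; ∃-syntax; _,_; proj₁; proj₂)
open import Data.Sum.Base using (_⊎_; inj₁; inj₂)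
open import Function.Base using (_∘_)
open import Function.Bundles using (mk⇔)
open import Level using (0ℓ)
open import Relation.Binary.Construct.Closure.ReflexiveTransitive using (ε; _◅_)
open import Relation.Binary.PropositionalEquality using
  (_≡_; _≢_; _≗_; refl; sym; trans; cong; cong₂; subst; subst₂; isEquivalence; module ≡-Reasoning)
open import Relation.Nullary.Decidable using
  (Dec; yes; no; does; map′; does-⇔; dec-true; dec-false)
open import Relation.Nullary.Negation using (contradiction)

-- Sums modulo 2.

xorSum : ℕ → (ℕ → Bool) → Bool
xorSum zero    h = false
xorSum (suc k) h = h 0 xor xorSum k (h ∘ suc)

xorSum-cong : ∀ k {h h′ : ℕ → Bool} → h ≗ h′ → xorSum k h ≡ xorSum k h′
xorSum-cong zero    eq = refl
xorSum-cong (suc k) eq = cong₂ _xor_ (eq 0) (xorSum-cong k (eq ∘ suc))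

xorSum-+ : ∀ k l h → xorSum (k + l) h ≡ xorSum k h xor xorSum l (h ∘ (k +_))
xorSum-+ zero    l h = refl
xorSum-+ (suc k) l h =
  trans (cong (h 0 xor_) (xorSum-+ k l (h ∘ suc))) (sym (xor-assoc (h 0) _ _))

-- Two identical halves cancel modulo 2. This is what kills the reflections met along `(s i · s j)`
-- to the power `m i j`.
xorSum-periodic : ∀ k h → (∀ i → h (k + i) ≡ h i) → xorSum (k + k) h ≡ false
xorSum-periodic k h per = begin
  xorSum (k + k) h                      ≡⟨ xorSum-+ k k h ⟩
  xorSum k h xor xorSum k (h ∘ (k +_))  ≡⟨ cong (xorSum k h xor_) (xorSum-cong k per) ⟩
  xorSum k h xor xorSum k h             ≡⟨ xor-same (xorSum k h) ⟩
  false                                 ∎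
  where open ≡-Reasoning

module Coxeter (C : CoxeterSystem) where
  open CoxeterSystem C

  -- The group W, conjugation, and involutive generators.

  groupW : Group 0ℓ 0ℓ
  groupW = record
    { isGroup = record
      { isMonoid = record
        { isSemigroup = record
          { isMagma = record { isEquivalence = isEquivalence ; ∙-cong = cong₂ _·_ }
          ; assoc = ·-assoc }
        ; identity = ·-idˡ , ·-idʳ }
      ; inverse = ·-invˡ , ·-invʳ
      ; ⁻¹-cong = cong inv } }

  open GroupProperties groupW using
    (\\-leftDividesˡ; \\-leftDividesʳ; //-rightDividesˡ; quasigroup)

  cancelˡ : ∀ x {y z} → x · y ≡ x · z → y ≡ z
  cancelˡ x = QuasigroupProperties.cancelˡ quasigroup x _ _

  cancelʳ : ∀ x {y z} → y · x ≡ z · x → y ≡ z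
  cancelʳ x = QuasigroupProperties.cancelʳ quasigroup x _ _

  conj : W → W → W
  conj x t = inv x · (t · x)

  conj-spec : ∀ x t → x · conj x t ≡ t · x
  conj-spec x t = \\-leftDividesˡ x (t · x)

  conj-unique : ∀ x {t y} → t · x ≡ x · y → conj x t ≡ y
  conj-unique x {y = y} eq = trans (cong (inv x ·_) eq) (\\-leftDividesʳ x y)

  conj-e : ∀ t → conj e t ≡ t
  conj-e t = conj-unique e (trans (·-idʳ t) (sym (·-idˡ t)))

  -- Conjugation acts on the right, so precomposing functions on W with it is a left action, as the
  -- product of `semidirect` requires.
  conj-· : ∀ x y t → conj (x · y) t ≡ conj y (conj x t)
  conj-· x y t = conj-unique (x · y) (begin
    t · (x · y)                    ≡⟨ ·-assoc t x y ⟨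
    (t · x) · y                    ≡⟨ cong (_· y) (conj-spec x t) ⟨
    (x · conj x t) · y             ≡⟨ ·-assoc x _ y ⟩
    x · (conj x t · y)             ≡⟨ cong (x ·_) (conj-spec y (conj x t)) ⟨
    x · (y · conj y (conj x t))    ≡⟨ ·-assoc x y _ ⟨
    (x · y) · conj y (conj x t)    ∎)
    where open ≡-Reasoning

  s-sq : ∀ i → s i · s i ≡ e
  s-sq i = begin
    s i · s i                       ≡⟨ ·-idʳ _ ⟨
    pow _·_ e (s i · s i) 1         ≡⟨ cong (pow _·_ e (s i · s i)) (m-diag i) ⟨
    pow _·_ e (s i · s i) (m i i)   ≡⟨ relations i i ⟩
    e                               ∎
    where open ≡-Reasoning

  s-cancelˡ : ∀ i x → s i · (s i · x) ≡ x
  s-cancelˡ i x = trans (sym (·-assoc _ _ _)) (trans (cong (_· x) (s-sq i)) (·-idˡ x))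

  s-cancelʳ : ∀ i x → (x · s i) · s i ≡ x
  s-cancelʳ i x = trans (·-assoc _ _ _) (trans (cong (x ·_) (s-sq i)) (·-idʳ x))

  -- The homomorphism W → 2^W ⋊ W and the inversion cocycle.

  _==_ : W → W → Bool
  x == y = does (x ≟W y)

  ==-refl : ∀ {x y} → x ≡ y → (x == y) ≡ true
  ==-refl {x} {y} = dec-true (x ≟W y)

  ==-cong : ∀ {x y x′ y′} → (x ≡ y → x′ ≡ y′) → (x′ ≡ y′ → x ≡ y) → (x == y) ≡ (x′ == y′)
  ==-cong {x} {y} {x′} {y′} f g = does-⇔ (mk⇔ f g) (x ≟W y) (x′ ≟W y′)

  -- 2^W ⋊ W rather than 2^T ⋊ W with T the set of reflections: this avoids a subtype of W.
  semidirect : Group 0ℓ 0ℓ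
  semidirect = record
    { Carrier = (W → Bool) × W
    ; _≈_ = λ (f , x) (g , y) → f ≗ g × x ≡ y
    ; _∙_ = λ (f , x) (g , y) → (λ t → f t xor g (conj x t)) , x · y
    ; ε = (λ _ → false) , e
    ; _⁻¹ = λ (f , x) → (λ t → f (conj (inv x) t)) , inv x
    ; isGroup = record
      { isMonoid = record
        { isSemigroup = record
          { isMagma = record
            { isEquivalence = record
              { refl = (λ _ → refl) , refl
              ; sym = λ (p , q) → (λ t → sym (p t)) , sym q
              ; trans = λ (p , q) (p′ , q′) → (λ t → trans (p t) (p′ t)) , trans q q′ }
            ; ∙-cong = λ { (p , refl) (p′ , q′) →
                (λ t → cong₂ _xor_ (p t) (p′ _)) , cong₂ _·_ refl q′ } }
          ; assoc = λ (f , x) (g , y) (h , z) →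
              (λ t → trans (xor-assoc (f t) _ _)
                (cong (λ r → f t xor (g (conj x t) xor h r)) (conj-· x y t)))
              , ·-assoc x y z }
        ; identity = (λ (f , x) → (λ t → cong f (conj-e t)) , ·-idˡ x)
                   , (λ (f , x) → (λ t → xor-identityʳ (f t)) , ·-idʳ x) }
      ; inverse = (λ (f , x) → (λ t → xor-same (f _)) , ·-invˡ x)
                , (λ (f , x) → (λ t → trans
                     (cong (λ r → f t xor f r)
                       (trans (sym (conj-· x (inv x) t))
                         (trans (cong (λ z → conj z t) (·-invʳ x)) (conj-e t))))
                     (xor-same (f t))) , ·-invʳ x)
      ; ⁻¹-cong = λ { (p , refl) → (λ t → p _) , refl } } }

  module 𝔾 = Group semidirect

  -- With this choice the first component of the product along a word i₁ ... iₖ, evaluated at t, is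
  -- the parity of the number of l for which t is the prefix reflection s₁ ⋯ sₗ ⋯ s₁.
  generator : Fin n → 𝔾.Carrier
  generator i = (_== s i) , s i

  -- Since c s_i c = s_i (`flip`), moving c across s_i inverts it. Hence c⁻¹ t c = c^k s_i means t =
  -- c^(k+1) s_i c⁻¹ = c^(k+2) s_i: conjugation by c shifts the list of dihedral reflections by two
  -- places.
  dihedral-step : ∀ i j t k →
    (conj (s i · s j) t == (pow _·_ e (s i · s j) k · s i))
      ≡ (t == (pow _·_ e (s i · s j) (2 + k) · s i))
  dihedral-step i j t k = ==-cong
    (λ eq → cancelʳ c (begin
      t · c                     ≡⟨ conj-spec c t ⟨
      c · conj c t              ≡⟨ cong (c ·_) eq ⟩
      c · (ck · s i)            ≡⟨ shift ⟨
      ((c · (c · ck)) · s i) · c ∎))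
    (λ eq → conj-unique c (trans (cong (_· c) eq) shift))
    where
    open ≡-Reasoning
    c = s i · s j
    ck = pow _·_ e c k
    pow-comm : ∀ k → pow _·_ e c k · c ≡ c · pow _·_ e c k
    pow-comm zero = trans (·-idˡ c) (sym (·-idʳ c))
    pow-comm (suc k) = trans (·-assoc _ _ _) (cong (c ·_) (pow-comm k))
    flip : c · (s i · c) ≡ s i
    flip = begin
      c · (s i · (s i · s j))  ≡⟨ cong (c ·_) (s-cancelˡ i (s j)) ⟩
      (s i · s j) · s j        ≡⟨ s-cancelʳ j (s i) ⟩
      s i                      ∎
    shift : ((c · (c · ck)) · s i) · c ≡ c · (ck · s i)
    shift = begin
      ((c · (c · ck)) · s i) · c  ≡⟨ ·-assoc _ _ _ ⟩
      (c · (c · ck)) · (s i · c)  ≡⟨ ·-assoc _ _ _ ⟩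
      c · ((c · ck) · (s i · c))  ≡⟨ cong (λ z → c · (z · (s i · c))) (pow-comm k) ⟨
      c · ((ck · c) · (s i · c))  ≡⟨ cong (c ·_) (·-assoc _ _ _) ⟩
      c · (ck · (c · (s i · c)))  ≡⟨ cong (λ z → c · (ck · z)) flip ⟩
      c · (ck · s i)              ∎

  -- The reflections met along the word (s i s j)^k are (s i s j)^l s i for l < 2k.
  generator-pow : ∀ i j k → let c = s i · s j in
    pow 𝔾._∙_ 𝔾.ε (generator i 𝔾.∙ generator j) k
      𝔾.≈ ((λ t → xorSum (k * 2) (λ l → t == (pow _·_ e c l · s i))) , pow _·_ e c k)
  generator-pow i j zero = (λ _ → refl) , refl
  generator-pow i j (suc k) = (λ t → begin
    ((t == s i) xor (conj (s i) t == s j)) xor proj₁ (pow 𝔾._∙_ 𝔾.ε gg k) (conj c t)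
      ≡⟨ cong₂ _xor_ (cong₂ _xor_ (first t) (second t))
           (trans (proj₁ (generator-pow i j k) (conj c t))
                  (xorSum-cong (k * 2) (dihedral-step i j t))) ⟩
    (h t 0 xor h t 1) xor xorSum (k * 2) (h t ∘ suc ∘ suc)
      ≡⟨ xor-assoc (h t 0) _ _ ⟩
    xorSum (suc k * 2) (h t) ∎)
    , cong (c ·_) (proj₂ (generator-pow i j k))
    where
    open ≡-Reasoning
    c = s i · s j
    gg = generator i 𝔾.∙ generator j
    h : W → ℕ → Bool
    h t l = t == (pow _·_ e c l · s i)
    first : ∀ t → (t == s i) ≡ h t 0
    first t = cong (t ==_) (sym (·-idˡ (s i)))
    -- The second reflection met is s_i s_j s_i, which is c s_i.
    second : ∀ t → (conj (s i) t == s j) ≡ h t 1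
    second t = ==-cong
      (λ eq → cancelʳ (s i) (begin
        t · s i                          ≡⟨ conj-spec (s i) t ⟨
        s i · conj (s i) t               ≡⟨ cong (s i ·_) eq ⟩
        c                                ≡⟨ ·-idʳ c ⟨
        c · e                            ≡⟨ s-cancelʳ i (c · e) ⟨
        ((c · e) · s i) · s i            ∎))
      (λ eq → conj-unique (s i) (trans (cong (_· s i) eq)
        (trans (s-cancelʳ i (c · e)) (·-idʳ c))))

  -- As c^(m i j) = e, the sequence c^l s_i has period `m i j`, so its first 2 · `m i j` terms meet
  -- every reflection an even number of times.
  generator-relations : ∀ i j →
    pow 𝔾._∙_ 𝔾.ε (generator i 𝔾.∙ generator j) (m i j) 𝔾.≈ 𝔾.ε
  generator-relations i j = 𝔾.trans (generator-pow i j (m i j))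
    ((λ t → trans
        (cong (λ k → xorSum k (λ l → t == (pow _·_ e c l · s i))) double)
        (xorSum-periodic (m i j) _ (λ l → cong (λ z → t == (z · s i)) (periodic l))))
    , relations i j)
    where
    c = s i · s j
    double : m i j * 2 ≡ m i j + m i j
    double = trans (ℕ.*-comm (m i j) 2) (cong (m i j +_) (ℕ.+-identityʳ (m i j)))
    pow-+ : ∀ k l → pow _·_ e c (k + l) ≡ pow _·_ e c k · pow _·_ e c l
    pow-+ zero    l = sym (·-idˡ _)
    pow-+ (suc k) l = trans (cong (c ·_) (pow-+ k l)) (sym (·-assoc _ _ _))
    periodic : ∀ l → pow _·_ e c (m i j + l) ≡ pow _·_ e c l
    periodic l = trans (pow-+ (m i j) l) (trans (cong (_· pow _·_ e c l) (relations i j)) (·-idˡ _))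

  abstract
    lift : Σ (W → 𝔾.Carrier) λ φ →
             (∀ x y → φ (x · y) 𝔾.≈ φ x 𝔾.∙ φ y) × (∀ i → φ (s i) 𝔾.≈ generator i)
    lift = universal semidirect generator generator-relations

  -- Meaningful for reflections t only: inversion w t = true iff ℓ (t · w) < ℓ w.
  inversion : W → W → Bool
  inversion w = proj₁ (proj₁ lift w)

  -- `universal` promises multiplicativity only; the image of e is idempotent, and an idempotent of
  -- a group is the identity.
  lift-e : proj₁ lift e 𝔾.≈ 𝔾.ε
  lift-e = GroupLemma.identityˡ-unique (proj₁ lift e) (proj₁ lift e)
    (𝔾.sym (subst (λ z → proj₁ lift z 𝔾.≈ proj₁ lift e 𝔾.∙ proj₁ lift e) (·-idˡ e)
      (proj₁ (proj₂ lift) e e)))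
    where
    module GroupLemma = LoopProperties (GroupProperties.loop semidirect)

  inversion-e : ∀ t → inversion e t ≡ false
  inversion-e = proj₁ lift-e

  lift-proj₂ : ∀ w → proj₂ (proj₁ lift w) ≡ w
  lift-proj₂ w with generates w
  ... | ws , refl = go ws
    where
    go : ∀ ws → proj₂ (proj₁ lift (eval C ws)) ≡ eval C ws
    go []       = proj₂ lift-e
    go (i ∷ ws) = trans (proj₂ (proj₁ (proj₂ lift) (s i) (eval C ws)))
      (cong₂ _·_ (proj₂ (proj₂ (proj₂ lift) i)) (go ws))

  -- The cocycle rule behind all later computations: it is the first component of multiplicativity,
  -- with `lift-proj₂` identifying the acting element as x.
  inversion-· : ∀ x y t → inversion (x · y) t ≡ inversion x t xor inversion y (conj x t)
  inversion-· x y t = trans (proj₁ (proj₁ (proj₂ lift) x y) t)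
    (cong (λ z → inversion x t xor inversion y (conj z t)) (lift-proj₂ x))

  inversion-s : ∀ i t → inversion (s i) t ≡ (t == s i)
  inversion-s i = proj₁ (proj₂ (proj₂ lift) i)

  inversion-s-self : ∀ i → inversion (s i) (s i) ≡ true
  inversion-s-self i = trans (inversion-s i (s i)) (==-refl refl)

  -- Reflections and their effect on inversions.

  -- Turns right multiplication of u by `s i` into left multiplication by a reflection, the side on
  -- which inversions are recorded.
  ref : W → Fin n → W
  ref u i = u · (s i · inv u)

  ref-spec : ∀ u i → ref u i · u ≡ u · s i
  ref-spec u i = trans (·-assoc u _ u) (cong (u ·_) (//-rightDividesˡ u (s i)))

  ref-unique : ∀ u i {r} → r · u ≡ u · s i → ref u i ≡ r
  ref-unique u i eq = cancelʳ u (trans (ref-spec u i) (sym eq))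

  ref-sq : ∀ u i → ref u i · ref u i ≡ e
  ref-sq u i = cancelʳ u (begin
    (ref u i · ref u i) · u  ≡⟨ ·-assoc _ _ _ ⟩
    ref u i · (ref u i · u)  ≡⟨ cong (ref u i ·_) (ref-spec u i) ⟩
    ref u i · (u · s i)      ≡⟨ ·-assoc _ _ _ ⟨
    (ref u i · u) · s i      ≡⟨ cong (_· s i) (ref-spec u i) ⟩
    (u · s i) · s i          ≡⟨ s-cancelʳ i u ⟩
    u                        ≡⟨ ·-idˡ u ⟨
    e · u                    ∎)
    where open ≡-Reasoning

  ref-cancel : ∀ u i w → ref u i · (ref u i · w) ≡ w
  ref-cancel u i w =
    trans (sym (·-assoc _ _ _)) (trans (cong (_· w) (ref-sq u i)) (·-idˡ w))

  xor-true : ∀ b → b xor true ≡ not b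
  xor-true true  = refl
  xor-true false = refl

  inversion-·s : ∀ u i t → t · u ≡ u · s i → inversion (u · s i) t ≡ not (inversion u t)
  inversion-·s u i t eq = begin
    inversion (u · s i) t                       ≡⟨ inversion-· u (s i) t ⟩
    inversion u t xor inversion (s i) (conj u t)
      ≡⟨ cong (λ r → inversion u t xor inversion (s i) r) (conj-unique u eq) ⟩
    inversion u t xor inversion (s i) (s i)
      ≡⟨ cong (inversion u t xor_) (inversion-s-self i) ⟩
    inversion u t xor true                      ≡⟨ xor-true _ ⟩
    not (inversion u t)                         ∎
    where open ≡-Reasoning

  inversion-reflection : ∀ u i w → let t = ref u i in
    inversion (t · w) t ≡ not (inversion w t)
  inversion-reflection u i w = begin
    inversion (t · w) t                        ≡⟨ inversion-· t w t ⟩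
    inversion t t xor inversion w (conj t t)
      ≡⟨ cong₂ (λ b r → b xor inversion w r) self (conj-unique t refl) ⟩
    not (inversion w t)                        ∎
    where
    open ≡-Reasoning
    t = ref u i
    cancel-not : ∀ a b → a xor b ≡ not b → a ≡ true
    cancel-not true  _     _  = refl
    cancel-not false true  ()
    cancel-not false false ()
    -- Evaluate `inversion (t · u) t` twice: by the cocycle rule, where t is fixed under its own
    -- conjugation, and through t · u = u · s i, which flips `inversion u t`.
    self : inversion t t ≡ true
    self = cancel-not _ (inversion u t) (begin
      inversion t t xor inversion u t
        ≡⟨ cong (λ r → inversion t t xor inversion u r) (conj-unique t refl) ⟨
      inversion t t xor inversion u (conj t t)  ≡⟨ inversion-· t u t ⟨
      inversion (t · u) t                       ≡⟨ cong (λ x → inversion x t) (ref-spec u i) ⟩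
      inversion (u · s i) t                     ≡⟨ inversion-·s u i t (ref-spec u i) ⟩
      not (inversion u t)                       ∎)

  -- Words and strong exchange.

  Word : Set
  Word = List (Fin n)

  eval-++ : ∀ a b → eval C (a ++ b) ≡ eval C a · eval C b
  eval-++ []      b = sym (·-idˡ _)
  eval-++ (i ∷ a) b = trans (cong (s i ·_) (eval-++ a b)) (sym (·-assoc _ _ _))

  -- An odd number of prefix reflections equal t, so there is a first one, and its letter is
  -- deleted. Until it is reached, each letter passed conjugates t and leaves the tail with the same
  -- parity.
  deletion : ∀ a t → inversion (eval C a) t ≡ true →
    ∃[ p ] ∃[ i ] ∃[ q ] (a ≡ p ++ i ∷ q × t · eval C a ≡ eval C (p ++ q))
  deletion [] t inv-t = contradiction (trans (sym inv-t) (inversion-e t)) λ ()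
  deletion (i ∷ a) t inv-t with t ≟W s i
  ... | yes refl = [] , i , a , refl , s-cancelˡ i (eval C a)
  ... | no t≢s =
    let p , j , q , a≡ , del = deletion a (conj (s i) t) tail-inv
    in i ∷ p , j , q , cong (i ∷_) a≡ , (begin
      t · (s i · eval C a)             ≡⟨ ·-assoc _ _ _ ⟨
      (t · s i) · eval C a             ≡⟨ cong (_· eval C a) (conj-spec (s i) t) ⟨
      (s i · conj (s i) t) · eval C a  ≡⟨ ·-assoc _ _ _ ⟩
      s i · (conj (s i) t · eval C a)  ≡⟨ cong (s i ·_) del ⟩
      s i · eval C (p ++ q)            ∎)
    where
    open ≡-Reasoning
    tail-inv : inversion (eval C a) (conj (s i) t) ≡ true
    tail-inv = begin
      inversion (eval C a) (conj (s i) t)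
        ≡⟨ cong (_xor inversion (eval C a) (conj (s i) t))
             (trans (inversion-s i t) (dec-false (t ≟W s i) t≢s)) ⟨
      inversion (s i) t xor inversion (eval C a) (conj (s i) t)
        ≡⟨ inversion-· (s i) (eval C a) t ⟨
      inversion (s i · eval C a) t  ≡⟨ inv-t ⟩
      true                          ∎

  -- The length function.

  HasWord : ℕ → W → Set
  HasWord k w = ∃[ a ] (length a ≡ k × eval C a ≡ w)

  hasWord? : ∀ k w → Dec (HasWord k w)
  hasWord? zero w = map′ (λ eq → [] , refl , eq) (λ { ([] , _ , eq) → eq }) (e ≟W w)
  hasWord? (suc k) w = map′
    (λ { (i , a , len , eq) →
           i ∷ a , cong suc len , trans (cong (s i ·_) eq) (s-cancelˡ i w) })
    (λ { (i ∷ a , refl , refl) → i , a , refl , sym (s-cancelˡ i _) })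
    (any? (λ i → hasWord? k (s i · w)))

  -- Upward search for the least word length; the right alternative is the invariant that no word
  -- shorter than k evaluates to w. In `hasLength` a word from `generates` bounds the search.
  length-search : ∀ k w → (∃[ l ] HasLength C w l) ⊎ (∀ a → eval C a ≡ w → k ℕ.≤ length a)
  length-search zero    w = inj₂ λ _ _ → z≤n
  length-search (suc k) w with length-search k w
  ... | inj₁ found = inj₁ found
  ... | inj₂ k≤ with hasWord? k w
  ...   | yes word = inj₁ (k , word , k≤)
  ...   | no none  = inj₂ λ a eq →
            ℕ.≤∧≢⇒< (k≤ a eq) (λ k≡ → none (a , sym k≡ , eq))

  hasLength : ∀ w → ∃[ k ] HasLength C w k
  hasLength w with generates w
  ... | a , eq with length-search (suc (length a)) w
  ...   | inj₁ found = found
  ...   | inj₂ long  = contradiction (long a eq) (ℕ.<-irrefl refl)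

  ℓ : W → ℕ
  ℓ w = proj₁ (hasLength w)

  reducedWord : W → Word
  reducedWord w = proj₁ (proj₁ (proj₂ (hasLength w)))

  length-reducedWord : ∀ w → length (reducedWord w) ≡ ℓ w
  length-reducedWord w = proj₁ (proj₂ (proj₁ (proj₂ (hasLength w))))

  eval-reducedWord : ∀ w → eval C (reducedWord w) ≡ w
  eval-reducedWord w = proj₂ (proj₂ (proj₁ (proj₂ (hasLength w))))

  ℓ-min : ∀ a → ℓ (eval C a) ℕ.≤ length a
  ℓ-min a = proj₂ (proj₂ (hasLength (eval C a))) a refl

  ℓ-·-eval : ∀ w a → ℓ (w · eval C a) ℕ.≤ ℓ w + length a
  ℓ-·-eval w a = subst₂ (λ x k → ℓ x ℕ.≤ k)
    (trans (eval-++ (reducedWord w) a) (cong (_· eval C a) (eval-reducedWord w)))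
    (trans (length-++ (reducedWord w)) (cong (_+ length a) (length-reducedWord w)))
    (ℓ-min (reducedWord w ++ a))

  ℓ-·s : ∀ w i → ℓ (w · s i) ℕ.≤ suc (ℓ w)
  ℓ-·s w i = subst₂ (λ x k → ℓ (w · x) ℕ.≤ k) (·-idʳ (s i)) (ℕ.+-comm (ℓ w) 1)
    (ℓ-·-eval w (i ∷ []))

  ℓ⇒Shorter : ∀ {x y} → ℓ x ℕ.< ℓ y → Shorter C x y
  ℓ⇒Shorter {x} {y} lt = ℓ x , ℓ y , proj₂ (hasLength x) , proj₂ (hasLength y) , lt

  HasLength⇒ℓ : ∀ {w k} → HasLength C w k → k ≡ ℓ w
  HasLength⇒ℓ {w} ((a , refl , refl) , min) = ℕ.≤-antisym
    (subst (length a ℕ.≤_) (length-reducedWord w) (min (reducedWord w) (eval-reducedWord w))) (ℓ-min a)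

  Shorter⇒ℓ : ∀ {x y} → Shorter C x y → ℓ x ℕ.< ℓ y
  Shorter⇒ℓ (_ , _ , hx , hy , lt) = subst₂ ℕ._<_ (HasLength⇒ℓ hx) (HasLength⇒ℓ hy) lt

  -- Deleting a letter of a reduced word of w leaves a shorter word for t · w.
  inversion⇒ℓ< : ∀ w t → inversion w t ≡ true → ℓ (t · w) ℕ.< ℓ w
  inversion⇒ℓ< w t inv-t
    with reducedWord w | length-reducedWord w | eval-reducedWord w
  ... | a | len | refl with deletion a t inv-t
  ...   | p , i , q , refl , del = begin-strict
    ℓ (t · eval C (p ++ i ∷ q))  ≡⟨ cong ℓ del ⟩
    ℓ (eval C (p ++ q))          ≤⟨ ℓ-min (p ++ q) ⟩
    length (p ++ q)              ≡⟨ length-++ p ⟩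
    length p + length q          <⟨ ℕ.≤-refl ⟩
    suc (length p + length q)    ≡⟨ ℕ.+-suc (length p) (length q) ⟨
    length p + suc (length q)    ≡⟨ length-++ p ⟨
    length (p ++ i ∷ q)          ≡⟨ len ⟩
    ℓ (eval C (p ++ i ∷ q))      ∎
    where open ℕ.≤-Reasoning

  -- The right factor r = x s_i x⁻¹ is moved to the left as t = u r u⁻¹. Were t no inversion of w,
  -- it would be one of u = t · w by `inversion-reflection`, so w = t · u would be shorter than u.
  bruhatStep-inversion : ∀ {u w} → BruhatStep C u w →
    ∃[ t ] (inversion w t ≡ true × t · w ≡ u)
  bruhatStep-inversion {u} {w} (r , (x , i , r≡) , w≡ , short) = t , inv-t , tw≡u
    where
    open ≡-Reasoning
    t = ref (u · x) i
    tu≡w : t · u ≡ w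
    tu≡w = cancelʳ x (begin
      (t · u) · x                    ≡⟨ ·-assoc _ _ _ ⟩
      t · (u · x)                    ≡⟨ ref-spec (u · x) i ⟩
      (u · x) · s i                  ≡⟨ ·-assoc _ _ _ ⟩
      u · (x · s i)                  ≡⟨ cong (u ·_) (//-rightDividesˡ x (x · s i)) ⟨
      u · (((x · s i) · inv x) · x)  ≡⟨ cong (λ z → u · (z · x)) r≡ ⟨
      u · (r · x)                    ≡⟨ ·-assoc _ _ _ ⟨
      (u · r) · x                    ≡⟨ cong (_· x) w≡ ⟨
      w · x                          ∎)
    tw≡u : t · w ≡ u
    tw≡u = trans (cong (t ·_) (sym tu≡w)) (ref-cancel (u · x) i u)
    inv-t : inversion w t ≡ true
    inv-t with inversion w t in eq
    ... | true  = refl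
    ... | false = contradiction
      (subst (λ z → ℓ z ℕ.< ℓ u) tu≡w (inversion⇒ℓ< u t (begin
        inversion u t        ≡⟨ cong (λ z → inversion z t) tw≡u ⟨
        inversion (t · w) t  ≡⟨ inversion-reflection (u · x) i w ⟩
        not (inversion w t)  ≡⟨ cong not eq ⟩
        true                 ∎)))
      (ℕ.<-asym (Shorter⇒ℓ short))

  -- Left and right descents.

  -- Defined by inversions rather than lengths, so that descents obey the cocycle rule;
  -- `descentʳ-true` and `descentʳ-false` translate back to lengths.
  descentʳ : W → Fin n → Bool
  descentʳ u i = inversion u (ref u i)

  descentˡ : W → Fin n → Bool
  descentˡ u i = inversion u (s i)

  descentʳ-e : ∀ i → descentʳ e i ≡ false
  descentʳ-e i = inversion-e (ref e i)

  descentʳ-·s : ∀ u i → descentʳ (u · s i) i ≡ not (descentʳ u i)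
  descentʳ-·s u i = trans (cong (inversion (u · s i)) ref-·s) (inversion-·s u i _ (ref-spec u i))
    where
    ref-·s : ref (u · s i) i ≡ ref u i
    ref-·s = ref-unique (u · s i) i
      (trans (sym (·-assoc _ _ _)) (cong (_· s i) (ref-spec u i)))

  descentʳ-true : ∀ u i → descentʳ u i ≡ true → ℓ (u · s i) ℕ.< ℓ u
  descentʳ-true u i d = subst (λ x → ℓ x ℕ.< ℓ u) (ref-spec u i) (inversion⇒ℓ< u (ref u i) d)

  descentʳ-false : ∀ u i → descentʳ u i ≡ false → ℓ u ℕ.< ℓ (u · s i)
  descentʳ-false u i d = subst (λ x → ℓ x ℕ.< ℓ (u · s i)) (s-cancelʳ i u)
    (descentʳ-true (u · s i) i (trans (descentʳ-·s u i) (cong not d)))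

  descentˡ-·s : ∀ u i j →
    descentˡ (u · s j) i ≡ descentˡ u i xor ((s i · u) == (u · s j))
  descentˡ-·s u i j = trans (inversion-· u (s j) (s i)) (cong (descentˡ u i xor_)
    (trans (inversion-s j _) (==-cong
      (λ eq → trans (sym (conj-spec u (s i))) (cong (u ·_) eq)) (conj-unique u))))

  -- The cocycle term of `s i` tests whether the reflection is `s i`, which is the same coincidence
  -- s_i u = u s_j that corrects the left descent in `descentˡ-·s`. The other term is the right
  -- descent of u, because conjugation by `s i` gives `ref u j`.
  descentʳ-s· : ∀ u i j →
    descentʳ (s i · u) j ≡ descentʳ u j xor ((s i · u) == (u · s j))
  descentʳ-s· u i j = begin
    inversion (s i · u) t                             ≡⟨ inversion-· (s i) u t ⟩
    inversion (s i) t xor inversion u (conj (s i) t)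
      ≡⟨ cong₂ _xor_ (trans (inversion-s i t) (==-cong to from))
                     (cong (inversion u) conj-t) ⟩
    ((s i · u) == (u · s j)) xor descentʳ u j         ≡⟨ xor-comm _ (descentʳ u j) ⟩
    descentʳ u j xor ((s i · u) == (u · s j))         ∎
    where
    open ≡-Reasoning
    t = ref (s i · u) j
    conj-t : conj (s i) t ≡ ref u j
    conj-t = conj-unique (s i) (cancelʳ u (begin
      (t · s i) · u        ≡⟨ ·-assoc _ _ _ ⟩
      t · (s i · u)        ≡⟨ ref-spec (s i · u) j ⟩
      (s i · u) · s j      ≡⟨ ·-assoc _ _ _ ⟩
      s i · (u · s j)      ≡⟨ cong (s i ·_) (ref-spec u j) ⟨
      s i · (ref u j · u)  ≡⟨ ·-assoc _ _ _ ⟨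
      (s i · ref u j) · u  ∎))
    to : t ≡ s i → s i · u ≡ u · s j
    to eq = cancelˡ (s i) (begin
      s i · (s i · u)  ≡⟨ cong (_· (s i · u)) eq ⟨
      t · (s i · u)    ≡⟨ ref-spec (s i · u) j ⟩
      (s i · u) · s j  ≡⟨ ·-assoc _ _ _ ⟩
      s i · (u · s j)  ∎)
    from : s i · u ≡ u · s j → t ≡ s i
    from eq = ref-unique (s i · u) j
      (trans (cong (s i ·_) eq) (sym (·-assoc _ _ _)))

  descentʳ≡descentˡ : ∀ u i j → s i · u ≡ u · s j → descentʳ u j ≡ descentˡ u i
  descentʳ≡descentˡ u i j eq = cong (inversion u) (ref-unique u j eq)

  -- The recursion at q = 2 as commuting monotone operators.

  _≤̇_ : (W → ℕ) → (W → ℕ) → Set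
  f ≤̇ g = ∀ u → f u ℕ.≤ g u

  -- The two branches of the R-recursion with q - 1 = 1 and q = 2; d tells whether the generator is
  -- a descent.
  act : Bool → ℕ → ℕ → ℕ
  act d x y = if d then y else x + 2 * y

  act-mono : ∀ d {x x′ y y′} → x ℕ.≤ x′ → y ℕ.≤ y′ → act d x y ℕ.≤ act d x′ y′
  act-mono true  p q = q
  act-mono false p q = ℕ.+-mono-≤ p (ℕ.*-monoʳ-≤ 2 q)

  -- Here x, y, z, v stand for f at u, u s_j, s_i u, s_i u s_j, and c for the coincidence s_i u = u
  -- s_j. Without it the two descents are independent and both orders expand alike; with it the two
  -- descents and the two middle values agree.
  act-comm : ∀ c d d′ x y z v → (c ≡ true → d ≡ d′ × y ≡ z) →
    act d (act d′ x y) (act (d′ xor c) z v) ≡ act d′ (act d x z) (act (d xor c) y v)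
  act-comm true d d′ x y z v h with h refl
  act-comm true true  .true  x y .y v h | refl , refl = refl
  act-comm true false .false x y .y v h | refl , refl = refl
  act-comm false true  true  x y z v h = refl
  act-comm false true  false x y z v h = refl
  act-comm false false true  x y z v h = refl
  act-comm false false false x y z v h = expand x y z v
    where
    expand : ∀ x y z v → x + 2 * y + 2 * (z + 2 * v) ≡ x + 2 * z + 2 * (y + 2 * v)
    expand = solve-∀

  ρ λ′ : Fin n → (W → ℕ) → W → ℕ
  ρ  i f u = act (descentʳ u i) (f u) (f (u · s i))
  λ′ i f u = act (descentˡ u i) (f u) (f (s i · u))

  ρ-mono : ∀ i {f g} → f ≤̇ g → ρ i f ≤̇ ρ i g
  ρ-mono i le u = act-mono (descentʳ u i) (le u) (le (u · s i))

  λ′-mono : ∀ i {f g} → f ≤̇ g → λ′ i f ≤̇ λ′ i g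
  λ′-mono i le u = act-mono (descentˡ u i) (le u) (le (s i · u))

  ρ-cong : ∀ i {f g} → f ≗ g → ρ i f ≗ ρ i g
  ρ-cong i eq u = cong₂ (act (descentʳ u i)) (eq u) (eq (u · s i))

  λ′-ρ-comm : ∀ i j f → λ′ i (ρ j f) ≗ ρ j (λ′ i f)
  λ′-ρ-comm i j f u
    rewrite descentʳ-s· u i j | descentˡ-·s u i j | ·-assoc (s i) u (s j)
    = act-comm ((s i · u) == (u · s j)) (descentˡ u i) (descentʳ u j)
        (f u) (f (u · s j)) (f (s i · u)) (f (s i · (u · s j))) agree
    where
    agree : ((s i · u) == (u · s j)) ≡ true →
      descentˡ u i ≡ descentʳ u j × f (u · s j) ≡ f (s i · u)
    agree c with (s i · u) ≟W (u · s j)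
    ... | yes eq = sym (descentʳ≡descentˡ u i j eq) , cong f (sym eq)
    ... | no _ with () ← c

  -- The result is f(us) + 2f(u) at a descent and 3f(u) + 2f(us) otherwise. It serves the case where
  -- right multiplication shortens w.
  ρ-twice : ∀ i f → f ≤̇ ρ i (ρ i f)
  ρ-twice i f u rewrite descentʳ-·s u i | s-cancelʳ i u with descentʳ u i
  ... | true  = ℕ.≤-trans (ℕ.m≤m+n (f u) _) (ℕ.m≤n+m _ (f (u · s i)))
  ... | false = ℕ.≤-trans (ℕ.m≤m+n (f u) _) (ℕ.m≤m+n _ _)

  δ : W → ℕ
  δ u = if u == e then 1 else 0

  δ-≢ : ∀ {u} → u ≢ e → δ u ≡ 0
  δ-≢ {u} u≢e = cong (if_then 1 else 0) (dec-false (u ≟W e) u≢e)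

  s-comm : ∀ {u i} → u ≡ s i → s i · u ≡ u · s i
  s-comm refl = refl

  act-zero : ∀ d → act d 0 0 ≡ 0
  act-zero true  = refl
  act-zero false = refl

  -- If s u = u s, left and right data coincide. Otherwise u is neither e nor s, so every value of
  -- `δ` involved vanishes.
  λ′δ≗ρδ : ∀ i → λ′ i δ ≗ ρ i δ
  λ′δ≗ρδ i u with (s i · u) ≟W (u · s i)
  ... | yes eq = cong₂ (λ d x → act d (δ u) (δ x)) (sym (descentʳ≡descentˡ u i i eq)) eq
  ... | no neq
    rewrite δ-≢ {u} (λ { refl → neq (trans (·-idʳ _) (sym (·-idˡ _))) })
          | δ-≢ {u · s i} (λ eq → neq (s-comm (cancelʳ (s i) (trans eq (sym (s-sq i))))))
          | δ-≢ {s i · u} (λ eq → neq (s-comm (cancelˡ (s i) (trans eq (sym (s-sq i))))))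
    = trans (act-zero (descentˡ u i)) (sym (act-zero (descentʳ u i)))

  δ≤ρδ : ∀ i → δ ≤̇ ρ i δ
  δ≤ρδ i u with u ≟W e
  ... | no _ = z≤n
  ... | yes refl rewrite descentʳ-e i = s≤s z≤n

  -- Operators along words.

  -- The head letter acts innermost, so reading a word from the left follows the recursion from w to
  -- ws.
  ρ* : Word → (W → ℕ) → W → ℕ
  ρ* []      f = f
  ρ* (i ∷ a) f = ρ* a (ρ i f)

  ρ*-++ : ∀ a b f → ρ* (a ++ b) f ≡ ρ* b (ρ* a f)
  ρ*-++ []      b f = refl
  ρ*-++ (i ∷ a) b f = ρ*-++ a b (ρ i f)

  ρ*-mono : ∀ a {f g} → f ≤̇ g → ρ* a f ≤̇ ρ* a g
  ρ*-mono []      le = le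
  ρ*-mono (i ∷ a) le = ρ*-mono a (ρ-mono i le)

  ρ*-cong : ∀ a {f g} → f ≗ g → ρ* a f ≗ ρ* a g
  ρ*-cong []      eq = eq
  ρ*-cong (i ∷ a) eq = ρ*-cong a (ρ-cong i eq)

  λ′-ρ*-comm : ∀ i a f → λ′ i (ρ* a f) ≗ ρ* a (λ′ i f)
  λ′-ρ*-comm i []      f u = refl
  λ′-ρ*-comm i (j ∷ a) f u =
    trans (λ′-ρ*-comm i a (ρ j f) u) (ρ*-cong a (λ′-ρ-comm i j f) u)

  -- The innermost `ρ i` on `δ` is traded for `λ′ i`, which then commutes outwards past all other
  -- letters.
  ρ*δ≗λ′ : ∀ i a → ρ* (i ∷ a) δ ≗ λ′ i (ρ* a δ)
  ρ*δ≗λ′ i a u = trans (ρ*-cong a (sym ∘ λ′δ≗ρδ i) u) (sym (λ′-ρ*-comm i a δ u))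

  -- Building ρ* a δ up from the left by λ′ reduces this to δ ≤̇ ρ j δ, as λ′ commutes with ρ j.
  ρ*δ≤ρ : ∀ a j → ρ* a δ ≤̇ ρ j (ρ* a δ)
  ρ*δ≤ρ []      j   = δ≤ρδ j
  ρ*δ≤ρ (i ∷ a) j u = begin
    ρ* (i ∷ a) δ u           ≡⟨ ρ*δ≗λ′ i a u ⟩
    λ′ i (ρ* a δ) u          ≤⟨ λ′-mono i (ρ*δ≤ρ a j) u ⟩
    λ′ i (ρ j (ρ* a δ)) u    ≡⟨ λ′-ρ-comm i j (ρ* a δ) u ⟩
    ρ j (λ′ i (ρ* a δ)) u    ≡⟨ ρ-cong j (ρ*δ≗λ′ i a) u ⟨
    ρ j (ρ* (i ∷ a) δ) u     ∎
    where open ℕ.≤-Reasoning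

  -- No generator is a descent of e, so each letter adds an even number to the value there.
  ρ*-mod2 : ∀ a f → ∃[ k ] ρ* a f e ≡ f e + 2 * k
  ρ*-mod2 []      f = 0 , sym (ℕ.+-identityʳ (f e))
  ρ*-mod2 (i ∷ a) f with ρ*-mod2 a (ρ i f)
  ... | k , eq rewrite descentʳ-e i =
    f (e · s i) + k , trans eq (collect (f e) (f (e · s i)) k)
    where
    collect : ∀ x y k → x + 2 * y + 2 * k ≡ x + 2 * (y + k)
    collect = solve-∀

  δ-e : δ e ≡ 1
  δ-e = cong (if_then 1 else 0) (==-refl refl)

  -- Reduced words as ascending chains.

  data Ascending (p : W) : Word → Set where
    []  : Ascending p []
    _∷_ : ∀ {i a} → descentʳ p i ≡ false → Ascending (p · s i) a → Ascending p (i ∷ a)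

  -- The hypothesis says that every letter gains length. A descent at the first letter would leave
  -- the rest of the word too short to reach the required length.
  reduced⇒ascending : ∀ p a → ℓ p + length a ℕ.≤ ℓ (p · eval C a) → Ascending p a
  reduced⇒ascending p []      le = []
  reduced⇒ascending p (i ∷ a) le = ascent ∷ reduced⇒ascending (p · s i) a (begin
      ℓ (p · s i) + length a      ≤⟨ ℕ.+-monoˡ-≤ (length a) (ℓ-·s p i) ⟩
      suc (ℓ p) + length a        ≡⟨ ℕ.+-suc (ℓ p) (length a) ⟨
      ℓ p + suc (length a)        ≤⟨ le ⟩
      ℓ (p · (s i · eval C a))    ≡⟨ cong ℓ (·-assoc p (s i) (eval C a)) ⟨
      ℓ ((p · s i) · eval C a)    ∎)
    where
    open ℕ.≤-Reasoning
    ascent : descentʳ p i ≡ false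
    ascent with descentʳ p i in d
    ... | false = refl
    ... | true  = contradiction (begin-strict
      ℓ p + suc (length a)        ≤⟨ le ⟩
      ℓ (p · (s i · eval C a))    ≡⟨ cong ℓ (·-assoc p (s i) (eval C a)) ⟨
      ℓ ((p · s i) · eval C a)    ≤⟨ ℓ-·-eval (p · s i) a ⟩
      ℓ (p · s i) + length a      <⟨ ℕ.+-mono-<-≤ (descentʳ-true p i d) (ℕ.n≤1+n (length a)) ⟩
      ℓ p + suc (length a)        ∎) (ℕ.<-irrefl refl)

  ascending-reducedWord : ∀ w → Ascending e (reducedWord w)
  ascending-reducedWord w = reduced⇒ascending e (reducedWord w) (begin
    ℓ e + length (reducedWord w)      ≤⟨ ℕ.+-monoˡ-≤ _ (ℓ-min []) ⟩
    length (reducedWord w)            ≡⟨ length-reducedWord w ⟩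
    ℓ w                               ≡⟨ cong ℓ (eval-reducedWord w) ⟨
    ℓ (eval C (reducedWord w))        ≡⟨ cong ℓ (·-idˡ _) ⟨
    ℓ (e · eval C (reducedWord w))    ∎)
    where open ℕ.≤-Reasoning

  ≤B⇒ℓ≤ : ∀ {u w} → _≤B_ C u w → ℓ u ℕ.≤ ℓ w
  ≤B⇒ℓ≤ ε = ℕ.≤-refl
  ≤B⇒ℓ≤ ((_ , _ , _ , short) ◅ rest) = ℕ.≤-trans (ℕ.<⇒≤ (Shorter⇒ℓ short)) (≤B⇒ℓ≤ rest)

  ≤B-e : ∀ {u} → _≤B_ C u e → u ≡ e
  ≤B-e ε = refl
  ≤B-e ((_ , _ , _ , short) ◅ rest) = contradiction
    (ℕ.<-≤-trans (Shorter⇒ℓ short) (ℕ.≤-trans (≤B⇒ℓ≤ rest) (ℓ-min []))) λ ()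

  -- R-polynomials at 2, monotonicity and parity.

  module _ (R : W → W → ℤ → ℤ) (isR : IsRFamily C R) where
    open IsRFamily isR

    -- Values in ℕ make nonnegativity at q = 2 part of the induction.
    R-at-2 : W → (W → ℕ) → Set
    R-at-2 w f = ∀ u → R u w (pos 2) ≡ pos (f u)

    R-e : R-at-2 e δ
    R-e u with u ≟W e
    ... | yes refl = R-refl u (pos 2)
    ... | no u≢e   = R-not≤ u e (u≢e ∘ ≤B-e) (pos 2)

    R-·s : ∀ w i f → descentʳ w i ≡ false → R-at-2 w f → R-at-2 (w · s i) (ρ i f)
    R-·s w i f asc Rw u = go (descentʳ u i) refl
      where
      open ≡-Reasoning
      down : Shorter C ((w · s i) · s i) (w · s i)
      down = subst (λ z → Shorter C z (w · s i)) (sym (s-cancelʳ i w))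
        (ℓ⇒Shorter (descentʳ-false w i asc))
      Rwss : R-at-2 ((w · s i) · s i) f
      Rwss = subst (λ z → R-at-2 z f) (sym (s-cancelʳ i w)) Rw
      go : ∀ d → descentʳ u i ≡ d → R u (w · s i) (pos 2) ≡ pos (act d (f u) (f (u · s i)))
      go true d = trans
        (R-down u (w · s i) i down (ℓ⇒Shorter (descentʳ-true u i d)) (pos 2)) (Rwss (u · s i))
      go false d = begin
        R u (w · s i) (pos 2)
          ≡⟨ R-up u (w · s i) i down (ℓ⇒Shorter (descentʳ-false u i d)) (pos 2) ⟩
        pos 1 ℤ.* R u ((w · s i) · s i) (pos 2)
          ℤ.+ pos 2 ℤ.* R (u · s i) ((w · s i) · s i) (pos 2)
          ≡⟨ cong₂ (λ x y → pos 1 ℤ.* x ℤ.+ pos 2 ℤ.* y) (Rwss u) (Rwss (u · s i)) ⟩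
        pos 1 ℤ.* pos (f u) ℤ.+ pos 2 ℤ.* pos (f (u · s i))
          ≡⟨ cong₂ ℤ._+_ (ℤ.*-identityˡ (pos (f u))) (sym (ℤ.pos-* 2 (f (u · s i)))) ⟩
        pos (f u) ℤ.+ pos (2 * f (u · s i))
          ≡⟨ ℤ.pos-+ (f u) (2 * f (u · s i)) ⟨
        pos (f u + 2 * f (u · s i)) ∎

    R-ascending : ∀ w a f → Ascending w a → R-at-2 w f → R-at-2 (w · eval C a) (ρ* a f)
    R-ascending w [] f [] Rw = subst (λ z → R-at-2 z f) (sym (·-idʳ w)) Rw
    R-ascending w (i ∷ a) f (d ∷ asc) Rw =
      subst (λ z → R-at-2 z (ρ* a (ρ i f))) (·-assoc w (s i) (eval C a))
        (R-ascending (w · s i) a (ρ i f) asc (R-·s w i f d Rw))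

    r : W → W → ℕ
    r w = ρ* (reducedWord w) δ

    R≡r : ∀ w → R-at-2 w (r w)
    R≡r w = subst (λ z → R-at-2 z (r w)) (trans (·-idˡ _) (eval-reducedWord w))
      (R-ascending e (reducedWord w) δ (ascending-reducedWord w) R-e)

    -- Both functions compute the same integers R u w 2, so `r` does not depend on the chosen
    -- reduced word.
    r-unique : ∀ w f → R-at-2 w f → r w ≗ f
    r-unique w f Rw u = ℤ.+-injective (trans (sym (R≡r w u)) (Rw u))

    -- Equality at an ascent. At a descent, `r w` is `ρ i` of `r (w · s i)`, and `ρ-twice` applies.
    r-·s : ∀ w i → r (w · s i) ≤̇ ρ i (r w)
    r-·s w i = go (descentʳ w i) refl
      where
      ascent : ∀ w → descentʳ w i ≡ false → r (w · s i) ≗ ρ i (r w)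
      ascent w d = r-unique (w · s i) _ (R-·s w i (r w) d (R≡r w))
      go : ∀ d → descentʳ w i ≡ d → r (w · s i) ≤̇ ρ i (r w)
      go false d u = ℕ.≤-reflexive (ascent w d u)
      go true  d u = begin
        r (w · s i) u                ≤⟨ ρ-twice i (r (w · s i)) u ⟩
        ρ i (ρ i (r (w · s i))) u
          ≡⟨ ρ-cong i (ascent (w · s i) (trans (descentʳ-·s w i) (cong not d))) u ⟨
        ρ i (r ((w · s i) · s i)) u  ≡⟨ cong (λ z → ρ i (r z) u) (s-cancelʳ i w) ⟩
        ρ i (r w) u                  ∎
        where open ℕ.≤-Reasoning

    r-·-eval : ∀ w a → r (w · eval C a) ≤̇ ρ* a (r w)
    r-·-eval w []      u = ℕ.≤-reflexive (cong (λ z → r z u) (·-idʳ w))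
    r-·-eval w (i ∷ a) u = begin
      r (w · (s i · eval C a)) u  ≡⟨ cong (λ z → r z u) (·-assoc w (s i) (eval C a)) ⟨
      r ((w · s i) · eval C a) u  ≤⟨ r-·-eval (w · s i) a u ⟩
      ρ* a (r (w · s i)) u        ≤⟨ ρ*-mono a (r-·s w i) u ⟩
      ρ* a (ρ i (r w)) u          ∎
      where open ℕ.≤-Reasoning

    -- Covers words that need not be reduced, such as those left after deleting a letter.
    r-eval : ∀ a → r (eval C a) ≤̇ ρ* a δ
    r-eval a u = begin
      r (eval C a) u      ≡⟨ cong (λ z → r z u) (·-idˡ (eval C a)) ⟨
      r (e · eval C a) u  ≤⟨ r-·-eval e a u ⟩
      ρ* a (r e) u        ≡⟨ ρ*-cong a (r-unique e δ R-e) u ⟩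
      ρ* a δ u            ∎
      where open ℕ.≤-Reasoning

    r-step : ∀ {u w} → BruhatStep C u w → r u ≤̇ r w
    r-step {u} {w} step x with bruhatStep-inversion step
    ... | t , inv-t , tw≡u with deletion (reducedWord w) t
            (trans (cong (λ z → inversion z t) (eval-reducedWord w)) inv-t)
    ...   | p , i , q , a≡ , del = begin
      r u x                      ≡⟨ cong (λ z → r z x) u≡ ⟩
      r (eval C (p ++ q)) x      ≤⟨ r-eval (p ++ q) x ⟩
      ρ* (p ++ q) δ x            ≡⟨ cong (λ f → f x) (ρ*-++ p q δ) ⟩
      -- The deleted letter i is put back between p and q: `ρ i` can only enlarge what p has built,
      -- and the letters of q preserve the inequality.
      ρ* q (ρ* p δ) x            ≤⟨ ρ*-mono q (ρ*δ≤ρ p i) x ⟩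
      ρ* q (ρ i (ρ* p δ)) x      ≡⟨ cong (λ f → f x) (ρ*-++ p (i ∷ q) δ) ⟨
      ρ* (p ++ i ∷ q) δ x        ≡⟨ cong (λ a → ρ* a δ x) a≡ ⟨
      r w x                      ∎
      where
      open ℕ.≤-Reasoning
      u≡ : u ≡ eval C (p ++ q)
      u≡ = trans (sym tw≡u) (trans (cong (t ·_) (sym (eval-reducedWord w))) del)

    r-mono : ∀ {u w} → _≤B_ C u w → r u ≤̇ r w
    r-mono ε             x = ℕ.≤-refl
    r-mono (step ◅ rest) x = ℕ.≤-trans (r-step step x) (r-mono rest x)

    bruhatSize-mono : ∀ u v → _≤B_ C u v → bruhatSize C R u ≤ bruhatSize C R v
    bruhatSize-mono u v le =
      subst₂ _≤_ (sym (R≡r u e)) (sym (R≡r v e)) (+≤+ (r-mono le e))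

    bruhatSize-odd : ∀ v → OddInt (bruhatSize C R v)
    bruhatSize-odd v with ρ*-mod2 (reducedWord v) δ
    ... | k , eq = pos k , (begin
      R e v (pos 2)              ≡⟨ R≡r v e ⟩
      pos (r v e)                ≡⟨ cong pos (trans eq (cong (_+ 2 * k) δ-e)) ⟩
      pos (1 + 2 * k)            ≡⟨ ℤ.pos-+ 1 (2 * k) ⟩
      pos 1 ℤ.+ pos (2 * k)      ≡⟨ cong (ℤ._+_ (pos 1)) (ℤ.pos-* 2 k) ⟩
      pos 1 ℤ.+ pos 2 ℤ.* pos k  ∎)
      where open ≡-Reasoning

theorem1 : (C : CoxeterSystem) (R : CoxeterSystem.W C → CoxeterSystem.W C → ℤ → ℤ) →
    IsRFamily C R →
    ((u v : CoxeterSystem.W C) → _≤B_ C u v → bruhatSize C R u ≤ bruhatSize C R v)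
    × ((v : CoxeterSystem.W C) → OddInt (bruhatSize C R v))
theorem1 C R isR = bruhatSize-mono R isR , bruhatSize-odd R isR
  where open Coxeter C
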